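{- Let $S$ be a numerical semigroup, let $a\in S$ be nonzero, let $m$ be a positive integer, and suppose $\mathrm{Ap}(S;a)=\{0\}\cup\{\beta+i\delta : 1\le i\le a-1\}$ for some integers $\beta\ge 0$ and $\delta>0$. (When $a\ge3$, $\beta$ and $\delta$ are uniquely determined. For $a=1$, take $\beta=0$ and $\delta=1$. For $a=2$, take $\beta=0$ and $\delta$ odd.) Then $\mathrm{H}(S)$ is equidistributed modulo $m$ if and only if $\gcd(a\delta,m)=1$ and one of the following occurs: (1) $a\equiv1\pmod m$; or (2) $a\equiv2\pmod m$ and $\beta+\delta\equiv1\pmod m$; or (3) $\delta\equiv1\pmod m$ and $\beta\equiv0\pmod m$; or (4) $\delta\equiv-1\pmod m$ and $\beta\equiv a\pmod m$.
   Context: A numerical semigroup is a submonoid $S$ of $(\mathbb{N}_0,+)$ with finite complement; $\mathrm{H}(S)=\mathbb{N}_0\setminus S$ is its set of gaps. For nonzero $a\in S$, the Apéry set is $\mathrm{Ap}(S;a)=\{s\in S: s-a\notin S\}$; it has exactly $a$ elements. A finite (multi)set of integers is equidistributed modulo $m$ if it contains the same number of elements in each congruence class modulo $m$. "One of the following" is meant inclusively (at least one).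
   Formalization: When S = ℕ₀ (no gaps) it is additionally assumed that gcd(a,m)=1, since otherwise the empty set H(S) is equidistributed while gcd(aδ,m)≠1 (e.g. a=m=2, β=0, δ=1); membership in S is taken to be decidable, which is automatic classically. -}

module Defs where

open import Data.Integer.Base as ℤ using (ℤ; +_)
open import Data.Integer.Divisibility.Signed using (_∣_; _∣?_)
open import Data.List.Base using (List; filter; length; map)
open import Data.List.Membership.Propositional using () renaming (_∈_ to _∈ₗ_)
open import Data.List.Relation.Unary.Unique.Propositional using (Unique)
open import Data.Nat.Base using (ℕ; _+_; _*_; _∸_; _≤_)
open import Data.Product.Base using (_×_; ∃-syntax)
open import Data.Sum.Base using (_⊎_)
open import Function.Bundles using (_⇔_)
open import Level using (0ℓ)
open import Relation.Binary.PropositionalEquality using (_≡_)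
open import Relation.Nullary.Decidable using (Dec)
open import Relation.Unary using (Pred; Decidable; _∈_; _∉_; ∁)

infix 4 _≈_[mod_] _≈?_[mod_]

_≈_[mod_] : ℤ → ℤ → ℕ → Set
x ≈ y [mod m ] = + m ∣ x ℤ.- y

_≈?_[mod_] : ∀ x y m → Dec (x ≈ y [mod m ])
x ≈? y [mod m ] = + m ∣? (x ℤ.- y)

record Finite (P : Pred ℕ 0ℓ) : Set where
  field
    elements   : List ℕ
    unique     : Unique elements
    ∈-elements : ∀ n → n ∈ₗ elements ⇔ n ∈ P

-- Membership is required to be decidable; classically this is no restriction.
record NumericalSemigroup : Set₁ where
  field
    member            : Pred ℕ 0ℓ
    member?           : Decidable member
    0∈                : 0 ∈ member
    +-closed          : ∀ {x y} → x ∈ member → y ∈ member → x + y ∈ member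
    finite-complement : Finite (∁ member)

  gaps : List ℕ
  gaps = Finite.elements finite-complement

open NumericalSemigroup public using (member; gaps)

-- s - a is an integer and lies outside S when negative, so the condition
-- s - a ∉ S only concerns those naturals t for which t + a equals s.
Ap : NumericalSemigroup → ℕ → Pred ℕ 0ℓ
Ap S a s = s ∈ member S × (∀ t → t + a ≡ s → t ∉ member S)

-- {0} ∪ {β + iδ : 1 ≤ i ≤ a - 1}; only used with a nonzero.
ZeroAndProgression : (a β δ : ℕ) → Pred ℕ 0ℓ
ZeroAndProgression a β δ s =
  s ≡ 0 ⊎ (∃[ i ] (1 ≤ i × i ≤ a ∸ 1 × s ≡ β + i * δ))

-- Lists play the role of finite multisets; a residue class modulo m is given
-- by any of its integer representatives.
countInClass : ℕ → ℤ → List ℤ → ℕ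
countInClass m r xs = length (filter (λ x → x ≈? r [mod m ]) xs)

Equidistributed : ℕ → List ℤ → Set
Equidistributed m xs = ∀ r s → countInClass m r xs ≡ countInClass m s xs

H : NumericalSemigroup → List ℤ
H S = map +_ (gaps S)

{-# OPTIONS --safe #-}
module Submission where

-- Write a = n + 1. The gaps together with Ap(S;a) form the same set as {0, …, n} together with the
-- gaps shifted by a. Counting residues modulo m, if the gaps are equidistributed then
--   {β + iδ : 1 ≤ i ≤ n} = {1, …, n}  as multisets modulo m;                                    (∗)
-- conversely, if gcd(a, m) = 1, then (∗), even up to adding a constant to all residue counts, makes
-- the gap counts change by a constant along r, r - a, r - 2a, …, so that they are all equal.
-- Modulo m = a the shift by a is invisible and (∗) always holds, so a ∣ β; hence adding δ to a gap
-- gives a gap or a multiple of a, from which gcd(a, m) = 1 follows when some gap exists.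
-- Given (∗), telescoping with steps 1 and δ collapses it to the equality of two four-element
-- multisets, {1, a + δ, β + δ + 1, β + aδ} = {a, 1 + δ, β + aδ + 1, β + δ}, and matching the elements
-- leaves only the four cases.

open import Defs
open import Data.Integer.Base as ℤ using (ℤ; +_; -1ℤ; 0ℤ; 1ℤ; -[1+_])
import Data.Integer.Properties as ℤ
open import Data.Integer.Divisibility.Signed using (divides; ∣⇒∣ᵤ; ∣ᵤ⇒∣; ∣m∣n⇒∣m+n; ∣n⇒∣m*n) renaming (_∣_ to _∣ℤ_)
open import Data.Integer.Tactic.RingSolver using (solve; solve-∀)
open import Data.List.Base using (List; []; _∷_; [_]; _++_; map; filter; length; iterate; applyUpTo; upTo)
open import Data.List.Properties using (length-++; filter-++; length-filter; filter-accept; filter-reject; map-++)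
open import Data.List.Relation.Binary.Pointwise as Pointwise using (Pointwise)
open import Data.List.Relation.Binary.Permutation.Propositional using (_↭_)
open import Data.List.Relation.Binary.Permutation.Propositional.Properties using (filter-↭; ↭-length; map⁺; shift)
open import Data.List.Membership.Propositional using () renaming (_∈_ to _∈ₗ_)
open import Data.List.Membership.Propositional.Properties using (∈-++⁺ˡ; ∈-++⁺ʳ; ∈-++⁻; ∈-map⁺; ∈-map⁻; ∈-filter⁺; ∈-filter⁻; ∈-upTo⁺; ∈-upTo⁻; ∈-applyUpTo⁺; ∈-applyUpTo⁻)
open import Data.List.Membership.Propositional.Properties.WithK using (unique∧set⇒bag)
open import Data.List.Relation.Binary.BagAndSetEquality using (∼bag⇒↭)
open import Data.List.Membership.DecPropositional ℤ._≟_ using (_∈?_)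
open import Data.List.Relation.Unary.Unique.Propositional using (Unique)
import Data.List.Relation.Unary.Unique.Propositional.Properties as Unique
import Data.List.Relation.Unary.AllPairs as AllPairs
import Data.List.Relation.Unary.All as All
import Data.List.Relation.Unary.All.Properties as All
open import Data.Nat.Induction using (<-wellFounded)
open import Induction.WellFounded using (Acc; acc)
open import Data.List.Relation.Unary.Any using (Any; here; there)
open import Data.Nat.Base using (ℕ; zero; suc; _+_; _*_; _∸_; _≤_; _<_; s≤s; z≤n; NonZero; >-nonZero)
open import Data.Nat.Divisibility using (_∤_)
import Data.Nat.Divisibility as ℕ
open import Data.Nat.GCD using (gcd; gcd[m,n]∣m; gcd[m,n]∣n; module Bézout)
open import Data.Nat.Coprimality using (coprime-Bézout; gcd≡1⇒coprime; coprime⇒gcd≡1)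
import Data.Nat.Properties as ℕ
import Data.Nat.Tactic.RingSolver as ℕRing
open import Data.Product.Base using (_×_; _,_; ∃-syntax; proj₁; proj₂)
open import Data.Sum.Base using (_⊎_; inj₁; inj₂)
open import Function.Base using (_∘_)
open import Function.Bundles using (_⇔_; mk⇔; Equivalence)
open import Relation.Binary.PropositionalEquality using (_≡_; _≢_; refl; sym; trans; cong; cong₂; subst; subst₂; module ≡-Reasoning)
open import Relation.Nullary.Decidable using (yes; no)
open import Relation.Nullary.Negation using (¬_; contradiction)
open import Relation.Unary using (_∈_; _∉_; _≐_)

-- Arithmetic progressions as lists.

progression : ℤ → ℤ → ℕ → List ℤ
progression x d n = iterate (ℤ._+ d) x n

progression-∷ʳ : ∀ x d n → progression x d (suc n) ≡ progression x d n ++ [ x ℤ.+ + n ℤ.* d ]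
progression-∷ʳ x d zero    = cong [_] (solve (x ∷ d ∷ []))
progression-∷ʳ x d (suc n) = cong (x ∷_) (trans (progression-∷ʳ (x ℤ.+ d) d n)
  (cong (λ y → progression (x ℤ.+ d) d n ++ [ y ]) (lemma (+ n))))
  where
  lemma : ∀ k → x ℤ.+ d ℤ.+ k ℤ.* d ≡ x ℤ.+ (1ℤ ℤ.+ k) ℤ.* d
  lemma k = solve (x ∷ d ∷ k ∷ [])

-- Once a relation survives each step, two progressions need only be compared at their starts; it is
-- used with congruence and with translation.
iterate-pointwise : ∀ {A B : Set} {R : A → B → Set} {f g} →
  (∀ {x y} → R x y → R (f x) (g y)) →
  ∀ n {x y} → R x y → Pointwise R (iterate f x n) (iterate g y n)
iterate-pointwise step zero    r = Pointwise.[]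
iterate-pointwise step (suc n) r = r Pointwise.∷ iterate-pointwise step n (step r)

-- Congruences and invertibility

module _ {m : ℕ} where

  -- Most congruences below are derived by writing the new difference as an integer combination of
  -- one or two old ones, an identity left to the ring solver.
  combine₁ : ∀ c {s t} → + m ∣ℤ s → t ≡ c ℤ.* s → + m ∣ℤ t
  combine₁ c p eq = subst (+ m ∣ℤ_) (sym eq) (∣n⇒∣m*n c p)

  combine₂ : ∀ c c′ {s s′ t} → + m ∣ℤ s → + m ∣ℤ s′ → t ≡ c ℤ.* s ℤ.+ c′ ℤ.* s′ → + m ∣ℤ t
  combine₂ c c′ p p′ eq = subst (+ m ∣ℤ_) (sym eq) (∣m∣n⇒∣m+n (∣n⇒∣m*n c p) (∣n⇒∣m*n c′ p′))

  ≈-refl : ∀ x → x ≈ x [mod m ]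
  ≈-refl x = divides 0ℤ (ℤ.+-inverseʳ x)

  ≈-sym : ∀ x y → x ≈ y [mod m ] → y ≈ x [mod m ]
  ≈-sym x y p = combine₁ -1ℤ p (solve (x ∷ y ∷ []))

  ≈-trans : ∀ x y z → x ≈ y [mod m ] → y ≈ z [mod m ] → x ≈ z [mod m ]
  ≈-trans x y z p q = combine₂ 1ℤ 1ℤ p q (solve (x ∷ y ∷ z ∷ []))

-- Coprimality to `m` in Bézout form: it makes sense for any integer, and the inverse `u` can serve
-- as a coefficient in `combine₂`.
Invertible : ℤ → ℕ → Set
Invertible x m = ∃[ u ] u ℤ.* x ≈ 1ℤ [mod m ]

invertible-*ˡ : ∀ {m} x y → Invertible (x ℤ.* y) m → Invertible x m
invertible-*ˡ x y (u , p) = u ℤ.* y , combine₁ 1ℤ p (solve (u ∷ x ∷ y ∷ []))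

invertible-*ʳ : ∀ {m} x y → Invertible (x ℤ.* y) m → Invertible y m
invertible-*ʳ x y (u , p) = u ℤ.* x , combine₁ 1ℤ p (solve (u ∷ x ∷ y ∷ []))

invertible-* : ∀ {m} x y → Invertible x m → Invertible y m → Invertible (x ℤ.* y) m
invertible-* x y (u , p) (v , q) = u ℤ.* v , combine₂ (v ℤ.* y) 1ℤ p q (solve (u ∷ v ∷ x ∷ y ∷ []))

invertible-cancel : ∀ {m} x y → Invertible x m → y ℤ.* x ≈ 0ℤ [mod m ] → y ≈ 0ℤ [mod m ]
invertible-cancel x y (u , p) q = combine₂ (ℤ.- y) u p q (solve (u ∷ x ∷ y ∷ []))

-- A unit that vanishes forces 1 ≈ 0, so there is a single residue class. This settles the matches
-- that are possible only for `m = 1`.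
invertible∧≈0⇒≈ : ∀ {m} x → Invertible x m → x ≈ 0ℤ [mod m ] → ∀ y z → y ≈ z [mod m ]
invertible∧≈0⇒≈ x (u , p) q y z = combine₂ (z ℤ.- y) ((y ℤ.- z) ℤ.* u) p q (solve (u ∷ x ∷ y ∷ z ∷ []))

gcd≡1⇒invertible : ∀ n {m} → gcd n m ≡ 1 → Invertible (+ n) m
gcd≡1⇒invertible n {m} g with coprime-Bézout (gcd≡1⇒coprime g)
... | Bézout.+- x y eq = + x , divides (+ y) (begin
  + x ℤ.* + n ℤ.- 1ℤ           ≡⟨ cong (ℤ._- 1ℤ) (ℤ.pos-* x n) ⟨
  + (x * n) ℤ.- 1ℤ             ≡⟨ cong (λ k → + k ℤ.- 1ℤ) eq ⟨
  1ℤ ℤ.+ + (y * m) ℤ.- 1ℤ      ≡⟨ lemma (+ (y * m)) ⟩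
  + (y * m)                    ≡⟨ ℤ.pos-* y m ⟩
  + y ℤ.* + m                  ∎)
  where
  open ≡-Reasoning
  lemma : ∀ k → 1ℤ ℤ.+ k ℤ.- 1ℤ ≡ k
  lemma k = solve (k ∷ [])
-- Here `1 + x * n ≡ y * m`, so x n ≈ -1 and the inverse carries a minus sign.
... | Bézout.-+ x y eq = ℤ.- + x , divides (ℤ.- + y) (begin
  ℤ.- + x ℤ.* + n ℤ.- 1ℤ       ≡⟨ lemma (+ x) (+ n) ⟩
  ℤ.- (1ℤ ℤ.+ + x ℤ.* + n)     ≡⟨ cong (λ k → ℤ.- (1ℤ ℤ.+ k)) (ℤ.pos-* x n) ⟨
  ℤ.- + (1 + x * n)            ≡⟨ cong (λ k → ℤ.- + k) eq ⟩
  ℤ.- + (y * m)                ≡⟨ cong ℤ.-_ (ℤ.pos-* y m) ⟩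
  ℤ.- (+ y ℤ.* + m)            ≡⟨ ℤ.neg-distribˡ-* (+ y) (+ m) ⟩
  ℤ.- + y ℤ.* + m              ∎)
  where
  open ≡-Reasoning
  lemma : ∀ k l → ℤ.- k ℤ.* l ℤ.- 1ℤ ≡ ℤ.- (1ℤ ℤ.+ k ℤ.* l)
  lemma k l = solve (k ∷ l ∷ [])

≈-coarsen : ∀ {d m} x y → d ℕ.∣ m → x ≈ y [mod m ] → x ≈ y [mod d ]
≈-coarsen x y (ℕ.divides q refl) (divides k eq) = divides (k ℤ.* + q) (trans eq
  (trans (cong (k ℤ.*_) (ℤ.pos-* q _)) (sym (ℤ.*-assoc k (+ q) _))))

∣⇒≈0 : ∀ {d n} → d ℕ.∣ n → + n ≈ 0ℤ [mod d ]
∣⇒≈0 {d} {n} p = subst (+ d ∣ℤ_) (sym (ℤ.+-identityʳ (+ n))) (∣ᵤ⇒∣ {+ d} {+ n} p)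

≈0⇒∣ : ∀ {d n} → + n ≈ 0ℤ [mod d ] → d ℕ.∣ n
≈0⇒∣ {d} {n} p = ∣⇒∣ᵤ {+ d} {+ n} (subst (+ d ∣ℤ_) (ℤ.+-identityʳ (+ n)) p)

-- A common divisor of `n` and `m` divides u n and, by coarsening the modulus, also u n - 1; hence
-- it divides 1.
invertible⇒gcd≡1 : ∀ n {m} → Invertible (+ n) m → gcd n m ≡ 1
invertible⇒gcd≡1 n {m} (u , p) = coprime⇒gcd≡1 λ {d} (d∣n , d∣m) →
  ℕ.∣1⇒≡1 (≈0⇒∣ (combine₂ u -1ℤ (∣⇒≈0 d∣n) (≈-coarsen (u ℤ.* + n) 1ℤ d∣m p) (lemma (+ n))))
  where
  lemma : ∀ x → 1ℤ ℤ.- 0ℤ ≡ u ℤ.* (x ℤ.- 0ℤ) ℤ.+ -1ℤ ℤ.* (u ℤ.* x ℤ.- 1ℤ)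
  lemma x = solve (u ∷ x ∷ [])

-- Residue counts modulo m

module Counting (m : ℕ) where

  count : ℤ → List ℤ → ℕ
  count = countInClass m

  count-++ : ∀ r xs ys → count r (xs ++ ys) ≡ count r xs + count r ys
  count-++ r xs ys = trans (cong length (filter-++ (λ x → x ≈? r [mod m ]) xs ys))
    (length-++ (filter _ xs))

  count-∷ : ∀ r x xs → count r (x ∷ xs) ≡ count r [ x ] + count r xs
  count-∷ r x xs = count-++ r [ x ] xs

  count-↭ : ∀ r {xs ys} → xs ↭ ys → count r xs ≡ count r ys
  count-↭ r p = ↭-length (filter-↭ (λ x → x ≈? r [mod m ]) p)

  count-accept : ∀ r x xs → x ≈ r [mod m ] → count r (x ∷ xs) ≡ suc (count r xs)
  count-accept r x xs p = cong length (filter-accept (λ x → x ≈? r [mod m ]) p)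

  count-reject : ∀ r x xs → ¬ x ≈ r [mod m ] → count r (x ∷ xs) ≡ count r xs
  count-reject r x xs p = cong length (filter-reject (λ x → x ≈? r [mod m ]) p)

  -- The class may differ on the two sides, so one induction covers congruent entries, congruent
  -- representatives of the class, and a list translated together with its class.
  count-pointwise : ∀ r s {xs ys} → Pointwise (λ x y → x ≈ r [mod m ] ⇔ y ≈ s [mod m ]) xs ys →
    count r xs ≡ count s ys
  count-pointwise r s Pointwise.[] = refl
  count-pointwise r s {x ∷ xs} {y ∷ ys} (e Pointwise.∷ es) with x ≈? r [mod m ]
  ... | yes p = trans (count-accept r x xs p) (trans (cong suc (count-pointwise r s es))
                  (sym (count-accept s y ys (Equivalence.to e p))))
  ... | no ¬p = trans (count-reject r x xs ¬p) (trans (count-pointwise r s es)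
                  (sym (count-reject s y ys (¬p ∘ Equivalence.from e))))

  count-cong : ∀ r {xs ys} → Pointwise (_≈_[mod m ]) xs ys → count r xs ≡ count r ys
  count-cong r = count-pointwise r r ∘ Pointwise.map λ {x} {y} p →
    mk⇔ (≈-trans y x r (≈-sym x y p)) (≈-trans x y r p)

  count-[]-cong : ∀ r {x y} → x ≈ y [mod m ] → count r [ x ] ≡ count r [ y ]
  count-[]-cong r {x} {y} p = count-cong r {[ x ]} {[ y ]} (p Pointwise.∷ Pointwise.[])

  count-class : ∀ {r s} xs → r ≈ s [mod m ] → count r xs ≡ count s xs
  count-class {r} {s} xs p = count-pointwise r s {xs} (Pointwise.refl (λ {x} →
    mk⇔ (λ q → ≈-trans x r s q p) (λ q → ≈-trans x s r q (≈-sym r s p))))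

  count-shift : ∀ r d {xs ys} → Pointwise (λ x y → y ≡ x ℤ.+ d) xs ys →
    count (r ℤ.- d) xs ≡ count r ys
  count-shift r d = count-pointwise (r ℤ.- d) r ∘ Pointwise.map
    λ {x} → translated x
    where
    rearrange : ∀ x → x ℤ.- (r ℤ.- d) ≡ x ℤ.+ d ℤ.- r
    rearrange x = solve (x ∷ r ∷ d ∷ [])
    translated : ∀ x {y} → y ≡ x ℤ.+ d → x ≈ r ℤ.- d [mod m ] ⇔ y ≈ r [mod m ]
    translated x refl = mk⇔ (subst (+ m ∣ℤ_) (rearrange x)) (subst (+ m ∣ℤ_) (sym (rearrange x)))

  count-map-+ : ∀ r d xs → count (r ℤ.- + d) (map +_ xs) ≡ count r (map +_ (map (_+ d) xs))
  count-map-+ r d xs = count-shift r (+ d) (pointwise xs)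
    where
    pointwise : ∀ xs → Pointwise (λ x y → y ≡ x ℤ.+ + d) (map +_ xs) (map +_ (map (_+ d) xs))
    pointwise []       = Pointwise.[]
    pointwise (x ∷ xs) = refl Pointwise.∷ pointwise xs

  count≢0⇒Any : ∀ r xs → count r xs ≢ 0 → Any (λ x → x ≈ r [mod m ]) xs
  count≢0⇒Any r [] c = contradiction refl c
  count≢0⇒Any r (x ∷ xs) c with x ≈? r [mod m ]
  ... | yes p = here p
  ... | no ¬p = there (count≢0⇒Any r xs (c ∘ trans (count-reject r x xs ¬p)))

  -- Matching and cancelling entries of lists with equal residue counts.

  Equicounted : List ℤ → List ℤ → Set
  Equicounted xs ys = ∀ r → count r xs ≡ count r ys

  -- The class of `x` is inhabited on the left, so its count in `ys` is positive. The prefix `xs`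
  -- serves to point at the chosen entry.
  element-matches : ∀ xs {x xs′ ys} → Equicounted (xs ++ x ∷ xs′) ys → Any (λ y → y ≈ x [mod m ]) ys
  element-matches xs {x} {xs′} {ys} e = count≢0⇒Any x ys λ z → contradiction
    (begin
      suc (count x (xs ++ xs′)) ≡⟨ count-accept x x (xs ++ xs′) (≈-refl x) ⟨
      count x (x ∷ xs ++ xs′)   ≡⟨ count-↭ x (shift x xs xs′) ⟨
      count x (xs ++ x ∷ xs′)   ≡⟨ e x ⟩
      count x ys                ≡⟨ z ⟩
      0                         ∎)
    λ ()
    where open ≡-Reasoning

  drop-matching : ∀ xs ys {x y xs′ ys′} → x ≈ y [mod m ] →
    Equicounted (xs ++ x ∷ xs′) (ys ++ y ∷ ys′) → Equicounted (xs ++ xs′) (ys ++ ys′)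
  drop-matching xs ys {x} {y} {xs′} {ys′} p e r = ℕ.+-cancelˡ-≡ (count r [ x ]) _ _
    (begin
      count r [ x ] + count r (xs ++ xs′) ≡⟨ count-∷ r x _ ⟨
      count r (x ∷ xs ++ xs′)             ≡⟨ count-↭ r (shift x xs xs′) ⟨
      count r (xs ++ x ∷ xs′)             ≡⟨ e r ⟩
      count r (ys ++ y ∷ ys′)             ≡⟨ count-↭ r (shift y ys ys′) ⟩
      count r (y ∷ ys ++ ys′)             ≡⟨ count-∷ r y _ ⟩
      count r [ y ] + count r (ys ++ ys′) ≡⟨ cong (_+ count r (ys ++ ys′)) (count-[]-cong r p) ⟨
      count r [ x ] + count r (ys ++ ys′) ∎)
    where open ≡-Reasoning

  -- The entries of `xs` in the class are, up to order, a filtering of the entries of `ys` in the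
  -- class, and filtering does not lengthen a list.
  unique-⊆⇒count-≤ : ∀ r {xs ys} → Unique xs → Unique ys →
    (∀ {x} → x ∈ₗ xs → x ≈ r [mod m ] → x ∈ₗ ys) → count r xs ≤ count r ys
  unique-⊆⇒count-≤ r {xs} {ys} xs-unique ys-unique xs⊆ys = subst (_≤ count r ys)
    (sym (↭-length (∼bag⇒↭ (unique∧set⇒bag (Unique.filter⁺ class? xs-unique)
      (Unique.filter⁺ (_∈? X) (Unique.filter⁺ class? ys-unique)) (mk⇔ to from)))))
    (length-filter (_∈? X) (filter class? ys))
    where
    class? = λ x → x ≈? r [mod m ]
    X = filter class? xs
    to : ∀ {x} → x ∈ₗ X → x ∈ₗ filter (_∈? X) (filter class? ys)
    to x∈X with x∈ , p ← ∈-filter⁻ class? {xs = xs} x∈X =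
      ∈-filter⁺ (_∈? X) (∈-filter⁺ class? (xs⊆ys x∈ p) p) x∈X
    from : ∀ {x} → x ∈ₗ filter (_∈? X) (filter class? ys) → x ∈ₗ X
    from x∈ = proj₂ (∈-filter⁻ (_∈? X) {xs = filter class? ys} x∈)

  -- Progressions modulo `m`.

  Any-progression : ∀ {r} x d n → Any (λ y → y ≈ r [mod m ]) (progression x d n) →
    ∃[ i ] x ℤ.+ i ℤ.* d ≈ r [mod m ]
  Any-progression {r} x d (suc n) (here p)  = 0ℤ , combine₁ 1ℤ p (solve (x ∷ d ∷ r ∷ []))
  Any-progression {r} x d (suc n) (there p) with i , q ← Any-progression (x ℤ.+ d) d n p =
    1ℤ ℤ.+ i , subst (λ y → y ≈ r [mod m ]) (step x d i) q
    where
    step : ∀ x d i → x ℤ.+ d ℤ.+ i ℤ.* d ≡ x ℤ.+ (1ℤ ℤ.+ i) ℤ.* d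
    step = solve-∀

  progression-cong : ∀ r n {x y d e} → x ≈ y [mod m ] → d ≈ e [mod m ] →
    count r (progression x d n) ≡ count r (progression y e n)
  progression-cong r n {d = d} {e} p q = count-cong r (iterate-pointwise (λ {x} {y} → step x y) n p)
    where
    step : ∀ x y → x ≈ y [mod m ] → x ℤ.+ d ≈ y ℤ.+ e [mod m ]
    step x y p = combine₂ 1ℤ 1ℤ p q (solve (x ∷ y ∷ d ∷ e ∷ []))

  progression-shift : ∀ r e x d n →
    count (r ℤ.- e) (progression x d n) ≡ count r (progression (x ℤ.+ e) d n)
  progression-shift r e x d n = count-shift r e (iterate-pointwise {R = λ x y → y ≡ x ℤ.+ e} (λ {x} → step {x}) n refl)
    where
    step : ∀ {x y} → y ≡ x ℤ.+ e → y ℤ.+ d ≡ x ℤ.+ d ℤ.+ e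
    step {x} refl = solve (x ∷ d ∷ e ∷ [])

  -- Both sides count x, x + d, ..., x + n d, with the first term split off on the left and the last
  -- on the right. As generating functions: (1 - X^d) P = X^x - X^(x + n d).
  progression-telescope : ∀ r x d n →
    count r [ x ] + count (r ℤ.- d) (progression x d n) ≡
    count r (progression x d n) + count r [ x ℤ.+ + n ℤ.* d ]
  progression-telescope r x d n = begin
    count r [ x ] + count (r ℤ.- d) (progression x d n)  ≡⟨ cong₂ _+_ refl (progression-shift r d x d n) ⟩
    count r [ x ] + count r (progression (x ℤ.+ d) d n)  ≡⟨ count-∷ r x _ ⟨
    count r (progression x d (suc n))                    ≡⟨ cong (count r) (progression-∷ʳ x d n) ⟩
    count r (progression x d n ++ [ x ℤ.+ + n ℤ.* d ])   ≡⟨ count-++ r (progression x d n) _ ⟩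
    count r (progression x d n) + count r [ x ℤ.+ + n ℤ.* d ] ∎
    where open ≡-Reasoning

  -- Both lists consist of x + d, ..., x + n d, the first read from the far end; the case d ≈ -1
  -- rests on this.
  progression-reverse : ∀ r x d n →
    count r (progression (x ℤ.+ + n ℤ.* d) (ℤ.- d) n) ≡ count r (progression (x ℤ.+ d) d n)
  progression-reverse r x d zero    = refl
  progression-reverse r x d (suc n) = begin
    count r (z ∷ progression (z ℤ.- d) (ℤ.- d) n)              ≡⟨ cong₂ (λ s t → count r (s ∷ progression t (ℤ.- d) n)) eq₁ eq₂ ⟩
    count r (y ∷ progression (x ℤ.+ + n ℤ.* d) (ℤ.- d) n)      ≡⟨ count-∷ r y _ ⟩
    count r [ y ] + count r (progression (x ℤ.+ + n ℤ.* d) (ℤ.- d) n) ≡⟨ cong₂ _+_ refl (progression-reverse r x d n) ⟩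
    count r [ y ] + count r (progression (x ℤ.+ d) d n)        ≡⟨ ℕ.+-comm (count r [ y ]) _ ⟩
    count r (progression (x ℤ.+ d) d n) + count r [ y ]        ≡⟨ count-++ r (progression (x ℤ.+ d) d n) _ ⟨
    count r (progression (x ℤ.+ d) d n ++ [ y ])               ≡⟨ cong (count r) (progression-∷ʳ (x ℤ.+ d) d n) ⟨
    count r (progression (x ℤ.+ d) d (suc n))                  ∎
    where
    open ≡-Reasoning
    y z : ℤ
    y = x ℤ.+ d ℤ.+ + n ℤ.* d
    z = x ℤ.+ + suc n ℤ.* d
    lemma₁ : ∀ k → x ℤ.+ (1ℤ ℤ.+ k) ℤ.* d ≡ x ℤ.+ d ℤ.+ k ℤ.* d
    lemma₁ k = solve (x ∷ d ∷ k ∷ [])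
    eq₁ : z ≡ y
    eq₁ = lemma₁ (+ n)
    lemma₂ : ∀ k → x ℤ.+ (1ℤ ℤ.+ k) ℤ.* d ℤ.- d ≡ x ℤ.+ k ℤ.* d
    lemma₂ k = solve (x ∷ d ∷ k ∷ [])
    eq₂ : z ℤ.- d ≡ x ℤ.+ + n ℤ.* d
    eq₂ = lemma₂ (+ n)

  -- Functions on residue classes that change by a constant at each step.

  module _ {f : ℤ → ℕ} (f-cong : ∀ {r s} → r ≈ s [mod m ] → f r ≡ f s) {d : ℤ} where

    -- This is f (r - k d) = f r + k (p - q), written without subtraction in ℕ.
    iterate-drift : ∀ {p q} → (∀ r → f r + p ≡ f (r ℤ.- d) + q) →
      ∀ k r → f r + k * p ≡ f (r ℤ.- + k ℤ.* d) + k * q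
    iterate-drift e zero r = cong (_+ 0) (cong f (start r))
      where
      start : ∀ r → r ≡ r ℤ.- 0ℤ ℤ.* d
      start r = solve (r ∷ d ∷ [])
    iterate-drift {p} {q} e (suc k) r = begin
      f r + (p + k * p)                          ≡⟨ ℕ.+-assoc (f r) p _ ⟨
      f r + p + k * p                            ≡⟨ cong (_+ k * p) (e r) ⟩
      f (r ℤ.- d) + q + k * p                    ≡⟨ swap (f (r ℤ.- d)) q (k * p) ⟩
      q + (f (r ℤ.- d) + k * p)                  ≡⟨ cong₂ _+_ {x = q} refl (iterate-drift e k (r ℤ.- d)) ⟩
      q + (f (r ℤ.- d ℤ.- + k ℤ.* d) + k * q)    ≡⟨ cong (λ y → q + (f y + k * q)) (regroup (+ k)) ⟩
      q + (f (r ℤ.- + suc k ℤ.* d) + k * q)      ≡⟨ swap′ q (f (r ℤ.- + suc k ℤ.* d)) (k * q) ⟩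
      f (r ℤ.- + suc k ℤ.* d) + (q + k * q)      ∎
      where
      open ≡-Reasoning
      swap : ∀ x y z → x + y + z ≡ y + (x + z)
      swap = ℕRing.solve-∀
      swap′ : ∀ x y z → x + (y + z) ≡ y + (x + z)
      swap′ = ℕRing.solve-∀
      regroup : ∀ j → r ℤ.- d ℤ.- j ℤ.* d ≡ r ℤ.- (1ℤ ℤ.+ j) ℤ.* d
      regroup j = solve (r ∷ d ∷ j ∷ [])

    -- As u d ≈ 1, taking u (r - s) steps of length `d` leads from `r` to `s` modulo `m`.
    invariant⇒constant : Invertible d m → (∀ r → f r ≡ f (r ℤ.- d)) → ∀ r s → f r ≡ f s
    invariant⇒constant (u , p) e r s = trans (steps (u ℤ.* (r ℤ.- s)) r)
      (f-cong (combine₁ (s ℤ.- r) p (solve (u ∷ d ∷ r ∷ s ∷ []))))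
      where
      steps⁺ : ∀ k r → f r ≡ f (r ℤ.- + k ℤ.* d)
      steps⁺ k r = ℕ.+-cancelʳ-≡ (k * 0) _ _
        (iterate-drift (λ r → cong (_+ 0) (e r)) k r)
      steps : ∀ k r → f r ≡ f (r ℤ.- k ℤ.* d)
      steps (+ k)    r = steps⁺ k r
      -- A negative number of steps is read from its end point: k + 1 steps down from r + (k + 1) d
      -- return to `r`.
      steps -[1+ k ] r = sym (trans (steps⁺ (suc k) _) (cong f (back (+ suc k))))
        where
        back : ∀ j → r ℤ.- (ℤ.- j) ℤ.* d ℤ.- j ℤ.* d ≡ r
        back j = solve (r ∷ j ∷ d ∷ [])

    -- Going once around the cycle r, r - d, ..., r - m d accumulates m p on one side and m q on
    -- the other, so p = q.
    drift⇒constant : .{{NonZero m}} → Invertible d m → ∀ {p q} →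
      (∀ r → f r + p ≡ f (r ℤ.- d) + q) → ∀ r s → f r ≡ f s
    drift⇒constant inv {p} {q} e = invariant⇒constant inv λ r →
      ℕ.+-cancelʳ-≡ p _ _ (trans (e r) (cong₂ _+_ refl (sym p≡q)))
      where
      loop : 0ℤ ℤ.- + m ℤ.* d ≈ 0ℤ [mod m ]
      loop = divides (ℤ.- d) (lemma (+ m))
        where
        lemma : ∀ k → 0ℤ ℤ.- k ℤ.* d ℤ.- 0ℤ ≡ ℤ.- d ℤ.* k
        lemma k = solve (d ∷ k ∷ [])
      p≡q : p ≡ q
      p≡q = ℕ.*-cancelˡ-≡ p q m (ℕ.+-cancelˡ-≡ (f 0ℤ) _ _
        (trans (iterate-drift e m 0ℤ) (cong (_+ m * q) (f-cong loop))))

  -- Since `m` divides `n`, x + n d ≈ x, so the end terms of the telescoping relation cancel and the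
  -- counts are invariant under a shift by the invertible `d`.
  full-progression-constant : ∀ x d n → Invertible d m → + n ≈ 0ℤ [mod m ] →
    ∀ r s → count r (progression x d n) ≡ count s (progression x d n)
  full-progression-constant x d n inv p = invariant⇒constant (count-class (progression x d n)) inv λ r →
    ℕ.+-cancelʳ-≡ (count r [ x ]) _ _ (begin
      count r (progression x d n) + count r [ x ]                    ≡⟨ cong₂ _+_ refl (count-[]-cong r (wrap (+ n) p)) ⟩
      count r (progression x d n) + count r [ x ℤ.+ + n ℤ.* d ]      ≡⟨ progression-telescope r x d n ⟨
      count r [ x ] + count (r ℤ.- d) (progression x d n)            ≡⟨ ℕ.+-comm (count r [ x ]) _ ⟩
      count (r ℤ.- d) (progression x d n) + count r [ x ]            ∎)
    where
    open ≡-Reasoning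
    wrap : ∀ k → k ≈ 0ℤ [mod m ] → x ≈ x ℤ.+ k ℤ.* d [mod m ]
    wrap k q = combine₁ (ℤ.- d) q (solve (x ∷ k ∷ d ∷ []))

  -- Comparing the residues of b + i d with those of i, for 1 ≤ i ≤ n.

  module _ (b d : ℤ) where

    -- This is (∗); both progressions start at i = 1, hence at b + d and at 1.
    Balanced : ℕ → Set
    Balanced n = Equicounted (progression (b ℤ.+ d) d n) (progression 1ℤ 1ℤ n)

    -- For n ≥ 2 both 1 and 2 are congruent to terms of the progression, so their difference 1 is
    -- congruent to a multiple of `d`. For n = 1, b = 0 and b + d ≈ 1.
    balanced⇒invertible : ∀ n → (n ≡ 0 → d ≡ 1ℤ) → (n ≡ 1 → b ≡ 0ℤ) → Balanced n → Invertible d m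
    balanced⇒invertible zero d≡1 _ _ with refl ← d≡1 refl = 1ℤ , ≈-refl 1ℤ
    balanced⇒invertible 1 _ b≡0 e with element-matches [] {ys = [ 1ℤ ]} e
    ... | here p = 1ℤ , combine₂ -1ℤ -1ℤ p (subst (λ k → k ≈ 0ℤ [mod m ]) (sym (b≡0 refl)) (≈-refl 0ℤ)) (identity b d)
      where
      identity : ∀ b d → 1ℤ ℤ.* d ℤ.- 1ℤ ≡ -1ℤ ℤ.* (1ℤ ℤ.- (b ℤ.+ d)) ℤ.+ -1ℤ ℤ.* (b ℤ.- 0ℤ)
      identity = solve-∀
    balanced⇒invertible n@(suc (suc _)) _ _ e = difference
        (Any-progression (b ℤ.+ d) d n (element-matches [] (sym ∘ e)))
        (Any-progression (b ℤ.+ d) d n (element-matches [ 1ℤ ] (sym ∘ e)))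
      where
      difference : ∃[ i ] b ℤ.+ d ℤ.+ i ℤ.* d ≈ 1ℤ [mod m ] → ∃[ j ] b ℤ.+ d ℤ.+ j ℤ.* d ≈ + 2 [mod m ] →
        Invertible d m
      difference (i , p) (j , q) = j ℤ.- i , combine₂ -1ℤ 1ℤ p q (identity i j)
        where
        identity : ∀ i j → (j ℤ.- i) ℤ.* d ℤ.- 1ℤ ≡
          -1ℤ ℤ.* (b ℤ.+ d ℤ.+ i ℤ.* d ℤ.- 1ℤ) ℤ.+ 1ℤ ℤ.* (b ℤ.+ d ℤ.+ j ℤ.* d ℤ.- + 2)
        identity i j = solve (b ∷ d ∷ i ∷ j ∷ [])

    -- In the group ring of ℤ/m, multiplying Σ x^{b+id} = Σ x^i (1 ≤ i ≤ n) by (1 - x)(1 - x^d) gives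
    -- (1 - x)(x^{b+d} - x^{b+(n+1)d}) = (1 - x^d)(x - x^{n+1}); this is the expanded equation,
    -- with the negative terms moved to the other side.
    four-term : ∀ n → Balanced n → let A = 1ℤ ℤ.+ + n ℤ.* 1ℤ; B = b ℤ.+ d ℤ.+ + n ℤ.* d in
      Equicounted (1ℤ ∷ A ℤ.+ d ∷ b ℤ.+ d ℤ.+ 1ℤ ∷ B ∷ []) (A ∷ 1ℤ ℤ.+ d ∷ B ℤ.+ 1ℤ ∷ b ℤ.+ d ∷ [])
    four-term n e r = begin
      count r (1ℤ ∷ A ℤ.+ d ∷ b ℤ.+ d ℤ.+ 1ℤ ∷ B ∷ [])
        ≡⟨ split 1ℤ (A ℤ.+ d) (b ℤ.+ d ℤ.+ 1ℤ) B ⟩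
      count r [ 1ℤ ] + (count r [ A ℤ.+ d ] + (count r [ b ℤ.+ d ℤ.+ 1ℤ ] + count r [ B ]))
        ≡⟨ cancel (count r [ b ℤ.+ d ]) (count r [ B ]) (count r [ b ℤ.+ d ℤ.+ 1ℤ ]) (count r [ B ℤ.+ 1ℤ ])
             (count r [ 1ℤ ]) (count r [ A ]) (count r [ 1ℤ ℤ.+ d ]) (count r [ A ℤ.+ d ])
             (Q r) (Q (r ℤ.- 1ℤ)) (Q (r ℤ.- d)) (Q (r ℤ.- d ℤ.- 1ℤ))
             telescope-b
             (progression-telescope r 1ℤ 1ℤ n)
             (trans (cong (_+ Q (r ℤ.- d ℤ.- 1ℤ)) (sym (translate 1ℤ d)))
               (trans (progression-telescope (r ℤ.- d) 1ℤ 1ℤ n) (cong₂ _+_ {x = Q (r ℤ.- d)} refl (translate A d))))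
             telescope-b-1 ⟩
      count r [ A ] + (count r [ 1ℤ ℤ.+ d ] + (count r [ B ℤ.+ 1ℤ ] + count r [ b ℤ.+ d ]))
        ≡⟨ split A (1ℤ ℤ.+ d) (B ℤ.+ 1ℤ) (b ℤ.+ d) ⟨
      count r (A ∷ 1ℤ ℤ.+ d ∷ B ℤ.+ 1ℤ ∷ b ℤ.+ d ∷ []) ∎
      where
      open ≡-Reasoning
      A B : ℤ
      A = 1ℤ ℤ.+ + n ℤ.* 1ℤ
      B = b ℤ.+ d ℤ.+ + n ℤ.* d
      P Q : ℤ → ℕ
      P s = count s (progression (b ℤ.+ d) d n)
      Q s = count s (progression 1ℤ 1ℤ n)

      split : ∀ x y z w → count r (x ∷ y ∷ z ∷ w ∷ []) ≡
        count r [ x ] + (count r [ y ] + (count r [ z ] + count r [ w ]))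
      split x y z w = trans (count-∷ r x _) (cong₂ _+_ {x = count r [ x ]} refl
        (trans (count-∷ r y _) (cong₂ _+_ {x = count r [ y ]} refl (count-∷ r z _))))

      translate : ∀ x s → count (r ℤ.- s) [ x ] ≡ count r [ x ℤ.+ s ]
      translate x s = count-shift r s {[ x ]} {[ x ℤ.+ s ]} (refl Pointwise.∷ Pointwise.[])

      telescope-b : count r [ b ℤ.+ d ] + Q (r ℤ.- d) ≡ Q r + count r [ B ]
      telescope-b = subst₂ (λ s t → count r [ b ℤ.+ d ] + s ≡ t + count r [ B ]) (e (r ℤ.- d)) (e r)
        (progression-telescope r (b ℤ.+ d) d n)

      commute : ∀ s → s ℤ.- 1ℤ ℤ.- d ≡ s ℤ.- d ℤ.- 1ℤ
      commute s = solve (s ∷ d ∷ [])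

      telescope-b-1 : count r [ b ℤ.+ d ℤ.+ 1ℤ ] + Q (r ℤ.- d ℤ.- 1ℤ) ≡ Q (r ℤ.- 1ℤ) + count r [ B ℤ.+ 1ℤ ]
      telescope-b-1 = begin
        count r [ b ℤ.+ d ℤ.+ 1ℤ ] + Q (r ℤ.- d ℤ.- 1ℤ)
          ≡⟨ cong₂ _+_ (translate (b ℤ.+ d) 1ℤ) (trans (e (r ℤ.- 1ℤ ℤ.- d)) (cong Q (commute r))) ⟨
        count (r ℤ.- 1ℤ) [ b ℤ.+ d ] + P (r ℤ.- 1ℤ ℤ.- d)
          ≡⟨ progression-telescope (r ℤ.- 1ℤ) (b ℤ.+ d) d n ⟩
        P (r ℤ.- 1ℤ) + count (r ℤ.- 1ℤ) [ B ]
          ≡⟨ cong₂ _+_ (e (r ℤ.- 1ℤ)) (translate B 1ℤ) ⟩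
        Q (r ℤ.- 1ℤ) + count r [ B ℤ.+ 1ℤ ] ∎

      -- In the sum of the second and fourth relations with the first and third reversed, each of
      -- `q`, `q₁`, `q₂`, `q₃` occurs once on either side.
      cancel : ∀ x x′ x₁ x₁′ y y′ y₁ y₁′ q q₁ q₂ q₃ →
        x + q₂ ≡ q + x′ → y + q₁ ≡ q + y′ → y₁ + q₃ ≡ q₂ + y₁′ → x₁ + q₃ ≡ q₁ + x₁′ →
        y + (y₁′ + (x₁ + x′)) ≡ y′ + (y₁ + (x₁′ + x))
      cancel x x′ x₁ x₁′ y y′ y₁ y₁′ q q₁ q₂ q₃ e₁ e₂ e₃ e₄ =
        ℕ.+-cancelʳ-≡ (q + q₁ + q₂ + q₃) _ _ (begin
          y + (y₁′ + (x₁ + x′)) + (q + q₁ + q₂ + q₃)      ≡⟨ collect y y₁′ x₁ x′ q q₁ q₂ q₃ ⟩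
          (y + q₁) + (q₂ + y₁′) + (x₁ + q₃) + (q + x′)    ≡⟨ cong₂ _+_ (cong₂ _+_ (cong₂ _+_ e₂ (sym e₃)) e₄) (sym e₁) ⟩
          (q + y′) + (y₁ + q₃) + (q₁ + x₁′) + (x + q₂)    ≡⟨ collect′ y′ y₁ x₁′ x q q₁ q₂ q₃ ⟩
          y′ + (y₁ + (x₁′ + x)) + (q + q₁ + q₂ + q₃)      ∎)
        where
        collect : ∀ y y₁′ x₁ x′ q q₁ q₂ q₃ → y + (y₁′ + (x₁ + x′)) + (q + q₁ + q₂ + q₃) ≡
          (y + q₁) + (q₂ + y₁′) + (x₁ + q₃) + (q + x′)
        collect = ℕRing.solve-∀
        collect′ : ∀ y′ y₁ x₁′ x q q₁ q₂ q₃ → (q + y′) + (y₁ + q₃) + (q₁ + x₁′) + (x + q₂) ≡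
          y′ + (y₁ + (x₁′ + x)) + (q + q₁ + q₂ + q₃)
        collect′ = ℕRing.solve-∀

    -- At `b = + β` and `d = + δ` this unfolds definitionally to the disjunction in the theorem.
    Cases : ℤ → Set
    Cases a = a ≈ 1ℤ [mod m ]
      ⊎ (a ≈ + 2 [mod m ] × b ℤ.+ d ≈ 1ℤ [mod m ])
      ⊎ (d ≈ 1ℤ [mod m ] × b ≈ 0ℤ [mod m ])
      ⊎ (d ≈ -1ℤ [mod m ] × b ≈ a [mod m ])

    -- The entry 1 on the left is congruent to an entry on the right: `A` gives case (1), 1 + d
    -- makes the unit `d` vanish, and B + 1 or b + d is cancelled against it before a second entry
    -- is matched.
    four-term⇒cases : ∀ k → Invertible (1ℤ ℤ.+ k) m → Invertible d m →
      let A = 1ℤ ℤ.+ k ℤ.* 1ℤ; B = b ℤ.+ d ℤ.+ k ℤ.* d in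
      Equicounted (1ℤ ∷ A ℤ.+ d ∷ b ℤ.+ d ℤ.+ 1ℤ ∷ B ∷ []) (A ∷ 1ℤ ℤ.+ d ∷ B ℤ.+ 1ℤ ∷ b ℤ.+ d ∷ []) →
      Cases (1ℤ ℤ.+ k)
    four-term⇒cases k a-inv d-inv e = match-1 (element-matches [] e)
      where
      kd≈0⇒case-1 : k ℤ.* d ≈ 0ℤ [mod m ] → Cases (1ℤ ℤ.+ k)
      kd≈0⇒case-1 p = inj₁ (combine₁ 1ℤ (invertible-cancel d k d-inv p) (solve (k ∷ [])))

      -- With 1 and b + d cancelled, b + d + 1 is matched: `A` gives case (2), 1 + d gives case (3),
      -- and B + 1 gives k d ≈ 0.
      match-b+d+1 : let A = 1ℤ ℤ.+ k ℤ.* 1ℤ; B = b ℤ.+ d ℤ.+ k ℤ.* d in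
        b ℤ.+ d ≈ 1ℤ [mod m ] →
        Any (λ y → y ≈ b ℤ.+ d ℤ.+ 1ℤ [mod m ]) (A ∷ 1ℤ ℤ.+ d ∷ B ℤ.+ 1ℤ ∷ []) → Cases (1ℤ ℤ.+ k)
      match-b+d+1 p (here q) =
        inj₂ (inj₁ (combine₂ 1ℤ 1ℤ p q (solve (b ∷ d ∷ k ∷ [])) , p))
      match-b+d+1 p (there (here q)) =
        inj₂ (inj₂ (inj₁ (combine₂ 1ℤ 1ℤ p q (solve (b ∷ d ∷ [])) , combine₁ -1ℤ q (solve (b ∷ d ∷ [])))))
      match-b+d+1 p (there (there (here q))) = kd≈0⇒case-1 (combine₁ 1ℤ q (solve (b ∷ d ∷ k ∷ [])))

      -- With 1 and B + 1 cancelled, so B ≈ 0, the entry `B` is matched: `A` makes the unit 1 + k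
      -- vanish, 1 + d gives case (4), and b + d gives k d ≈ 0.
      match-B : let A = 1ℤ ℤ.+ k ℤ.* 1ℤ; B = b ℤ.+ d ℤ.+ k ℤ.* d in
        B ℤ.+ 1ℤ ≈ 1ℤ [mod m ] →
        Any (λ y → y ≈ B [mod m ]) (A ∷ 1ℤ ℤ.+ d ∷ b ℤ.+ d ∷ []) → Cases (1ℤ ℤ.+ k)
      match-B p (here q) = inj₁ (invertible∧≈0⇒≈ (1ℤ ℤ.+ k) a-inv
        (combine₂ 1ℤ 1ℤ p q (solve (b ∷ d ∷ k ∷ []))) (1ℤ ℤ.+ k) 1ℤ)
      match-B p (there (here q)) =
        inj₂ (inj₂ (inj₂ (combine₂ 1ℤ 1ℤ p q (solve (b ∷ d ∷ k ∷ []))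
          , combine₂ (ℤ.- k) (ℤ.- (1ℤ ℤ.+ k)) p q (solve (b ∷ d ∷ k ∷ [])))))
      match-B p (there (there (here q))) = kd≈0⇒case-1 (combine₁ -1ℤ q (solve (b ∷ d ∷ k ∷ [])))

      match-1 : let A = 1ℤ ℤ.+ k ℤ.* 1ℤ; B = b ℤ.+ d ℤ.+ k ℤ.* d in
        Any (λ y → y ≈ 1ℤ [mod m ]) (A ∷ 1ℤ ℤ.+ d ∷ B ℤ.+ 1ℤ ∷ b ℤ.+ d ∷ []) → Cases (1ℤ ℤ.+ k)
      match-1 (here p) = inj₁ (combine₁ 1ℤ p (solve (k ∷ [])))
      match-1 (there (here p)) = inj₁ (invertible∧≈0⇒≈ d d-inv
        (combine₁ 1ℤ p (solve (d ∷ []))) (1ℤ ℤ.+ k) 1ℤ)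
      match-1 (there (there (here p))) =
        let A = 1ℤ ℤ.+ k ℤ.* 1ℤ; B = b ℤ.+ d ℤ.+ k ℤ.* d in
        match-B p (element-matches (A ℤ.+ d ∷ b ℤ.+ d ℤ.+ 1ℤ ∷ [])
          (drop-matching [] (A ∷ 1ℤ ℤ.+ d ∷ []) (≈-sym (B ℤ.+ 1ℤ) 1ℤ p) e))
      match-1 (there (there (there (here p)))) =
        let A = 1ℤ ℤ.+ k ℤ.* 1ℤ; B = b ℤ.+ d ℤ.+ k ℤ.* d in
        match-b+d+1 p (element-matches [ A ℤ.+ d ]
          (drop-matching [] (A ∷ 1ℤ ℤ.+ d ∷ B ℤ.+ 1ℤ ∷ []) (≈-sym (b ℤ.+ d) 1ℤ p) e))

    -- Prefixing `b` to one progression and 0 to the other yields `m` terms with invertible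
    -- difference, hence constant counts. So the counts of the two progressions drop by one exactly
    -- at `b` and at 0 respectively; being equal, they drop at the same class.
    balanced⇒≈0 : ∀ n → m ≡ suc n → Invertible d m → Balanced n → b ≈ 0ℤ [mod m ]
    balanced⇒≈0 n refl d-inv e with b ≈? 0ℤ [mod m ]
    ... | yes b≈0 = b≈0
    ... | no  b≉0 = contradiction
      (begin
        count 0ℤ Q             ≡⟨ e 0ℤ ⟨
        count 0ℤ P             ≡⟨ count-reject 0ℤ b P b≉0 ⟨
        count 0ℤ (b ∷ P)       ≡⟨ full-progression-constant b d m d-inv m≈0 0ℤ b ⟩
        count b (b ∷ P)        ≡⟨ count-accept b b P (≈-refl b) ⟩
        suc (count b P)        ≡⟨ cong suc (e b) ⟩
        suc (count b Q)        ≡⟨ cong suc (count-reject b 0ℤ Q (b≉0 ∘ ≈-sym 0ℤ b)) ⟨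
        suc (count b (0ℤ ∷ Q)) ≡⟨ cong suc (full-progression-constant 0ℤ 1ℤ m (1ℤ , ≈-refl 1ℤ) m≈0 b 0ℤ) ⟩
        suc (count 0ℤ (0ℤ ∷ Q)) ≡⟨ cong suc (count-accept 0ℤ 0ℤ Q (≈-refl 0ℤ)) ⟩
        suc (suc (count 0ℤ Q)) ∎)
      (ℕ.m≢1+n+m (count 0ℤ Q) {1})
      where
      open ≡-Reasoning
      P Q : List ℤ
      P = progression (b ℤ.+ d) d n
      Q = progression 1ℤ 1ℤ n
      m≈0 : + m ≈ 0ℤ [mod m ]
      m≈0 = ∣⇒≈0 ℕ.∣-refl

    -- In case (1) `m` divides `n`, and both progressions have constant counts. In case (2) the
    -- first terms agree and this applies to the rest. In cases (3) and (4) the progressions agree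
    -- modulo `m`, in the same or the opposite order.
    cases⇒balanced-up-to-constant : ∀ n → Invertible d m → Cases (+ suc n) →
      ∃[ p ] ∃[ q ] ∀ r → count r (progression (b ℤ.+ d) d n) + q ≡ count r (progression 1ℤ 1ℤ n) + p
    cases⇒balanced-up-to-constant n d-inv = λ where
        (inj₁ a≈1)                     → full n (combine₁ 1ℤ a≈1 (minus-one (+ n)))
        (inj₂ (inj₁ (a≈2 , b+d≈1)))    → full-but-first n a≈2 b+d≈1
        (inj₂ (inj₂ (inj₁ (d≈1 , b≈0)))) → 0 , 0 , λ r → cong (_+ 0)
          (progression-cong r n (combine₂ 1ℤ 1ℤ d≈1 b≈0 (solve (b ∷ d ∷ []))) d≈1)
        (inj₂ (inj₂ (inj₂ (d≈-1 , b≈a)))) → 0 , 0 , λ r → cong (_+ 0)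
          (trans (progression-cong r n (reversed (+ n) d≈-1 b≈a) d≈-1) (progression-reverse r 0ℤ 1ℤ n))
      where
      one-inv : Invertible 1ℤ m
      one-inv = 1ℤ , ≈-refl 1ℤ

      minus-one : ∀ k → k ℤ.- 0ℤ ≡ 1ℤ ℤ.* (1ℤ ℤ.+ k ℤ.- 1ℤ)
      minus-one k = solve (k ∷ [])

      reversed : ∀ k → d ≈ -1ℤ [mod m ] → b ≈ 1ℤ ℤ.+ k [mod m ] → b ℤ.+ d ≈ 0ℤ ℤ.+ k ℤ.* 1ℤ [mod m ]
      reversed k p q = combine₂ 1ℤ 1ℤ p q (solve (b ∷ d ∷ k ∷ []))

      full-at : ∀ l x y → + l ≈ 0ℤ [mod m ] → ∀ r →
        count r (progression x d l) + count 0ℤ (progression y 1ℤ l) ≡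
        count r (progression y 1ℤ l) + count 0ℤ (progression x d l)
      full-at l x y l≈0 r = trans
        (cong₂ _+_ (full-progression-constant x d l d-inv l≈0 r 0ℤ)
                   (full-progression-constant y 1ℤ l one-inv l≈0 0ℤ r))
        (ℕ.+-comm (count 0ℤ (progression x d l)) _)

      full : ∀ n → + n ≈ 0ℤ [mod m ] →
        ∃[ p ] ∃[ q ] ∀ r → count r (progression (b ℤ.+ d) d n) + q ≡ count r (progression 1ℤ 1ℤ n) + p
      full n n≈0 = _ , _ , full-at n (b ℤ.+ d) 1ℤ n≈0

      full-but-first : ∀ n → + suc n ≈ + 2 [mod m ] → b ℤ.+ d ≈ 1ℤ [mod m ] →
        ∃[ p ] ∃[ q ] ∀ r → count r (progression (b ℤ.+ d) d n) + q ≡ count r (progression 1ℤ 1ℤ n) + p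
      -- With `n = 0` there is no first term to split off, and both progressions are empty.
      full-but-first zero    a≈2 b+d≈1 = full zero (≈-refl 0ℤ)
      full-but-first (suc l) a≈2 b+d≈1 = p , q , λ r → (begin
        count r (b ℤ.+ d ∷ P) + q             ≡⟨ cong (_+ q) (count-∷ r (b ℤ.+ d) P) ⟩
        count r [ b ℤ.+ d ] + count r P + q   ≡⟨ ℕ.+-assoc (count r [ b ℤ.+ d ]) _ q ⟩
        count r [ b ℤ.+ d ] + (count r P + q) ≡⟨ cong₂ _+_ (count-[]-cong r b+d≈1)
                                                    (full-at l (b ℤ.+ d ℤ.+ d) (+ 2) (combine₁ 1ℤ a≈2 (minus-two (+ l))) r) ⟩
        count r [ 1ℤ ] + (count r Q + p)      ≡⟨ ℕ.+-assoc (count r [ 1ℤ ]) _ p ⟨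
        count r [ 1ℤ ] + count r Q + p        ≡⟨ cong (_+ p) (count-∷ r 1ℤ Q) ⟨
        count r (1ℤ ∷ Q) + p                  ∎)
        where
        open ≡-Reasoning
        P Q : List ℤ
        P = progression (b ℤ.+ d ℤ.+ d) d l
        Q = progression (+ 2) 1ℤ l
        p q : ℕ
        p = count 0ℤ P
        q = count 0ℤ Q
        minus-two : ∀ k → k ℤ.- 0ℤ ≡ 1ℤ ℤ.* (+ 2 ℤ.+ k ℤ.- + 2)
        minus-two k = solve (k ∷ [])

-- Gaps and the Apéry set

map-applyUpTo-progression : ∀ (f : ℕ → ℕ) d n → (∀ i → f (suc i) ≡ f i + d) →
  map +_ (applyUpTo f n) ≡ progression (+ f 0) (+ d) n
map-applyUpTo-progression f d zero    step = refl
map-applyUpTo-progression f d (suc n) step = cong (+ f 0 ∷_)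
  (trans (map-applyUpTo-progression (f ∘ suc) d n (step ∘ suc))
    (cong (λ k → progression (+ k) (+ d) n) (step 0)))

module Semigroup (S : NumericalSemigroup) where

  open NumericalSemigroup S using (member?; 0∈; +-closed; finite-complement)
  open Finite finite-complement using (unique; ∈-elements)

  ∈-gaps⁻ : ∀ {x} → x ∈ₗ gaps S → x ∉ member S
  ∈-gaps⁻ {x} = Equivalence.to (∈-elements x)

  ∈-gaps⁺ : ∀ {x} → x ∉ member S → x ∈ₗ gaps S
  ∈-gaps⁺ {x} = Equivalence.from (∈-elements x)

  *-closed : ∀ k {x} → x ∈ member S → k * x ∈ member S
  *-closed zero    x∈ = 0∈
  *-closed (suc k) x∈ = +-closed x∈ (*-closed k x∈)

  1∈⇒full : 1 ∈ member S → ∀ n → n ∈ member S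
  1∈⇒full 1∈ n = subst (_∈ member S) (ℕ.*-identityʳ n) (*-closed n 1∈)

  -- Subtract `a` as long as the result stays in `S`; the descent stops at an element of the Apéry
  -- set.
  apéry-descent : ∀ {a} → a ≢ 0 → ∀ s → s ∈ member S →
    ∃[ w ] ∃[ j ] (w ∈ Ap S a × s ≡ w + j * a)
  apéry-descent {a} a≢0 s = descend s (<-wellFounded s)
    where
    descend : ∀ s → Acc _<_ s → s ∈ member S → ∃[ w ] ∃[ j ] (w ∈ Ap S a × s ≡ w + j * a)
    descend s (acc rs) s∈ with a ℕ.≤? s
    ... | no a≰s = s , 0 , (s∈ , λ t t+a≡s _ → a≰s (subst (a ≤_) t+a≡s (ℕ.m≤n+m a t)))
                 , sym (ℕ.+-identityʳ s)
    ... | yes a≤s with member? (s ∸ a)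
    ...   | no s∸a∉ = s , 0
                    , (s∈ , λ t t+a≡s t∈ → s∸a∉ (subst (_∈ member S)
                        (trans (sym (ℕ.m+n∸n≡m t a)) (cong (_∸ a) t+a≡s)) t∈))
                    , sym (ℕ.+-identityʳ s)
    ...   | yes s∸a∈ with descend (s ∸ a) (rs (ℕ.∸-monoʳ-< (ℕ.n≢0⇒n>0 a≢0) a≤s)) s∸a∈
    ...     | w , j , w∈ , eq = w , suc j , w∈ , (begin
      s                  ≡⟨ ℕ.m∸n+n≡m a≤s ⟨
      s ∸ a + a          ≡⟨ cong (_+ a) eq ⟩
      w + j * a + a      ≡⟨ ℕ.+-assoc w (j * a) a ⟩
      w + (j * a + a)    ≡⟨ cong₂ _+_ {x = w} refl (ℕ.+-comm (j * a) a) ⟩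
      w + suc j * a      ∎)
      where open ≡-Reasoning

  -- With s - a computed in ℤ, both sides list {x ∈ ℕ : x - a ∉ S}: its elements are sorted by
  -- membership in S on the left and by x < a on the right.
  gaps-++-apéry : ∀ a → a ∈ member S → ∀ ws → Unique ws → (∀ x → x ∈ₗ ws ⇔ x ∈ Ap S a) →
    gaps S ++ ws ↭ upTo a ++ map (_+ a) (gaps S)
  gaps-++-apéry a a∈ ws ws-unique ws-apéry = ∼bag⇒↭ (unique∧set⇒bag
    (Unique.++⁺ unique ws-unique λ (x∈gaps , x∈ws) →
      ∈-gaps⁻ x∈gaps (proj₁ (Equivalence.to (ws-apéry _) x∈ws)))
    (Unique.++⁺ (Unique.upTo⁺ a) (Unique.map⁺ (ℕ.+-cancelʳ-≡ a _ _) unique) λ (x∈upTo , x∈map) →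
      upTo-map-disjoint (∈-upTo⁻ x∈upTo) (∈-map⁻ (_+ a) x∈map))
    (mk⇔ to from))
    where
    upTo-map-disjoint : ∀ {x} → x < a → ¬ (∃[ h ] (h ∈ₗ gaps S × x ≡ h + a))
    upTo-map-disjoint x<a (h , _ , refl) = ℕ.m+n≮n h a x<a

    classify : ∀ x → (∀ t → t + a ≡ x → t ∉ member S) → x ∈ₗ upTo a ++ map (_+ a) (gaps S)
    classify x p with x ℕ.<? a
    ... | yes x<a = ∈-++⁺ˡ (∈-upTo⁺ x<a)
    ... | no  x≮a = ∈-++⁺ʳ (upTo a) (subst (_∈ₗ map (_+ a) (gaps S)) eq
                      (∈-map⁺ (_+ a) (∈-gaps⁺ (p (x ∸ a) eq))))
      where
      eq : x ∸ a + a ≡ x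
      eq = ℕ.m∸n+n≡m (ℕ.≮⇒≥ x≮a)

    unclassify : ∀ x → (∀ t → t + a ≡ x → t ∉ member S) → x ∈ₗ gaps S ++ ws
    unclassify x p with member? x
    ... | yes x∈ = ∈-++⁺ʳ (gaps S) (Equivalence.from (ws-apéry x) (x∈ , p))
    ... | no  x∉ = ∈-++⁺ˡ (∈-gaps⁺ x∉)

    to : ∀ {x} → x ∈ₗ gaps S ++ ws → x ∈ₗ upTo a ++ map (_+ a) (gaps S)
    to {x} x∈ with ∈-++⁻ (gaps S) x∈
    ... | inj₁ x∈gaps = classify x λ where t refl t∈ → ∈-gaps⁻ x∈gaps (+-closed t∈ a∈)
    ... | inj₂ x∈ws   = classify x (proj₂ (Equivalence.to (ws-apéry x) x∈ws))

    from : ∀ {x} → x ∈ₗ upTo a ++ map (_+ a) (gaps S) → x ∈ₗ gaps S ++ ws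
    from {x} x∈ with ∈-++⁻ (upTo a) x∈
    ... | inj₁ x∈upTo = unclassify x λ where t refl _ → ℕ.m+n≮n t a (∈-upTo⁻ x∈upTo)
    ... | inj₂ x∈map with ∈-map⁻ (_+ a) x∈map
    ...   | h , h∈ , refl = unclassify x λ t eq t∈ →
              ∈-gaps⁻ h∈ (subst (_∈ member S) (ℕ.+-cancelʳ-≡ a t h eq) t∈)

  -- Semigroups whose Apéry set is 0 together with a progression.

  module _ (n β δ : ℕ) (a∈ : suc n ∈ member S) (0<δ : 0 < δ)
           (ap : Ap S (suc n) ≐ ZeroAndProgression (suc n) β δ) where

    private
      a : ℕ
      a = suc n

      -- The index is shifted by one, so that `applyUpTo w n` runs over the terms 1 ≤ i ≤ a - 1.
      w : ℕ → ℕ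
      w i = β + suc i * δ

      w-injective : ∀ {i j} → i < j → w i ≢ w j
      w-injective i<j = ℕ.<⇒≢ (ℕ.+-monoʳ-< β (ℕ.*-monoˡ-< δ {{>-nonZero 0<δ}} (s≤s i<j)))

      0<w : ∀ i → 0 < w i
      0<w i = ℕ.<-≤-trans 0<δ (ℕ.≤-trans (ℕ.m≤m+n δ (i * δ)) (ℕ.m≤n+m (suc i * δ) β))

      apéry : List ℕ
      apéry = 0 ∷ applyUpTo w n

      apéry-unique : Unique apéry
      apéry-unique = All.applyUpTo⁺₂ w n (λ i → ℕ.<⇒≢ (0<w i))
        AllPairs.∷ Unique.applyUpTo⁺₁ w n (λ i<j _ → w-injective i<j)

      ∈-apéry : ∀ x → x ∈ₗ apéry ⇔ x ∈ Ap S a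
      ∈-apéry x = mk⇔ (proj₂ ap ∘ to) (from ∘ proj₁ ap)
        where
        to : x ∈ₗ apéry → x ∈ ZeroAndProgression a β δ
        to (here x≡0) = inj₁ x≡0
        to (there x∈) with i , i<n , eq ← ∈-applyUpTo⁻ w x∈ = inj₂ (suc i , s≤s z≤n , i<n , eq)
        from : x ∈ ZeroAndProgression a β δ → x ∈ₗ apéry
        from (inj₁ x≡0) = here x≡0
        from (inj₂ (suc i , _ , i<n , refl)) = there (∈-applyUpTo⁺ w i<n)

      w∈ : ∀ i → i < n → w i ∈ member S
      w∈ i i<n = proj₁ (proj₂ ap (inj₂ (suc i , s≤s z≤n , i<n , refl)))

    module _ (m : ℕ) where
      open Counting m

      -- The residue count of `gaps-++-apéry`, after cancelling the 0 that both `apéry` and `upTo a`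
      -- contain.
      gaps-balance : ∀ r →
        count r (H S) + count r (progression (+ (β + δ)) (+ δ) n) ≡
        count r (progression 1ℤ 1ℤ n) + count (r ℤ.- + a) (H S)
      gaps-balance r = ℕ.+-cancelˡ-≡ (count r [ 0ℤ ]) _ _ (begin
        z + (count r (H S) + count r P)               ≡⟨ swap z (count r (H S)) (count r P) ⟩
        count r (H S) + (z + count r P)               ≡⟨ cong₂ _+_ refl (count-∷ r 0ℤ P) ⟨
        count r (H S) + count r (0ℤ ∷ P)              ≡⟨ cong (λ xs → count r (H S) + count r (0ℤ ∷ xs)) P≡ ⟨
        count r (H S) + count r (map +_ apéry)        ≡⟨ count-++ r (H S) _ ⟨
        count r (H S ++ map +_ apéry)                 ≡⟨ cong (count r) (map-++ +_ (gaps S) apéry) ⟨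
        count r (map +_ (gaps S ++ apéry))            ≡⟨ count-↭ r (map⁺ +_ (gaps-++-apéry a a∈ apéry apéry-unique ∈-apéry)) ⟩
        count r (map +_ (upTo a ++ shifted))          ≡⟨ cong (count r) (map-++ +_ (upTo a) shifted) ⟩
        count r (map +_ (upTo a) ++ map +_ shifted)   ≡⟨ count-++ r (map +_ (upTo a)) _ ⟩
        count r (map +_ (upTo a)) + count r (map +_ shifted) ≡⟨ cong₂ _+_ (cong (λ xs → count r (0ℤ ∷ xs)) Q≡) (sym (count-map-+ r a (gaps S))) ⟩
        count r (0ℤ ∷ Q) + count (r ℤ.- + a) (H S)    ≡⟨ cong (_+ count (r ℤ.- + a) (H S)) (count-∷ r 0ℤ Q) ⟩
        z + count r Q + count (r ℤ.- + a) (H S)       ≡⟨ ℕ.+-assoc z (count r Q) _ ⟩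
        z + (count r Q + count (r ℤ.- + a) (H S))     ∎)
        where
        open ≡-Reasoning
        P Q : List ℤ
        P = progression (+ (β + δ)) (+ δ) n
        Q = progression 1ℤ 1ℤ n
        z : ℕ
        z = count r [ 0ℤ ]
        shifted : List ℕ
        shifted = map (_+ a) (gaps S)
        swap : ∀ x y z → x + (y + z) ≡ y + (x + z)
        swap = ℕRing.solve-∀
        Q≡ : map +_ (applyUpTo suc n) ≡ Q
        Q≡ = map-applyUpTo-progression suc 1 n λ i → ℕ.+-comm 1 (suc i)
        P≡ : map +_ (applyUpTo w n) ≡ P
        P≡ = trans (map-applyUpTo-progression w δ n (step β δ))
          (cong (λ k → progression (+ (β + k)) (+ δ) n) (ℕ.*-identityˡ δ))
          where
          step : ∀ β δ i → β + (2 + i) * δ ≡ β + (1 + i) * δ + δ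
          step = ℕRing.solve-∀

    -- Otherwise h + δ is an Apéry element plus a multiple of `a`. The element 0 contradicts a ∤ h +
    -- δ; for β + i δ, removing δ writes h as β or an earlier Apéry element, plus a multiple of `a`.
    -- As a divides β, h lies in `S` either way.
    gap+δ : a ℕ.∣ β → ∀ h → h ∉ member S → a ∤ h + δ → h + δ ∉ member S
    gap+δ (ℕ.divides b refl) h h∉ a∤ h+δ∈ with apéry-descent (λ ()) (h + δ) h+δ∈
    ... | v , j , v∈ , eq with proj₁ ap v∈
    ...   | inj₁ refl = a∤ (ℕ.divides j eq)
    ...   | inj₂ (1 , _ , _ , refl) = h∉ (subst (_∈ member S) (sym h≡) (*-closed (b + j) a∈))
      where
      regroup : ∀ x y z → x + 1 * y + z ≡ (x + z) + y
      regroup = ℕRing.solve-∀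
      h≡ : h ≡ (b + j) * a
      h≡ = trans (ℕ.+-cancelʳ-≡ δ _ _ (trans eq (regroup (b * a) δ (j * a)))) (sym (ℕ.*-distribʳ-+ a b j))
    ...   | inj₂ (suc (suc i) , _ , i<n , refl) =
      h∉ (subst (_∈ member S) (sym h≡) (+-closed (w∈ i (ℕ.<-trans (ℕ.n<1+n i) i<n)) (*-closed j a∈)))
      where
      regroup : ∀ x y i z → x + (2 + i) * y + z ≡ x + (1 + i) * y + z + y
      regroup = ℕRing.solve-∀
      h≡ : h ≡ w i + j * a
      h≡ = ℕ.+-cancelʳ-≡ δ _ _ (trans eq (regroup β δ i (j * a)))

    private
      b d : ℤ
      b = + β
      d = + δ

    module _ (m : ℕ) where
      open Counting m

      equidistributed⇒balanced : Equidistributed m (H S) → Balanced b d n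
      equidistributed⇒balanced equi r = ℕ.+-cancelˡ-≡ (count r (H S)) _ _ (trans (gaps-balance m r)
        (trans (cong₂ _+_ {x = count r (progression 1ℤ 1ℤ n)} refl (equi (r ℤ.- + a) r))
          (ℕ.+-comm (count r (progression 1ℤ 1ℤ n)) _)))

      -- Combined with `gaps-balance`, the assumption makes the gap counts at r and r - a differ by
      -- a fixed amount, which is the drift that `drift⇒constant` excludes unless it is zero.
      balanced-up-to-constant⇒equidistributed : .{{NonZero m}} → Invertible (+ a) m → ∀ p q →
        (∀ r → count r (progression (b ℤ.+ d) d n) + q ≡ count r (progression 1ℤ 1ℤ n) + p) →
        Equidistributed m (H S)
      balanced-up-to-constant⇒equidistributed a-inv p q e = drift⇒constant (count-class (H S)) a-inv {p} {q} λ r →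
        cancel (count r (H S)) (count (r ℤ.- + a) (H S)) (count r (progression (b ℤ.+ d) d n))
          (count r (progression 1ℤ 1ℤ n)) (gaps-balance m r) (e r)
        where
        open ≡-Reasoning
        cancel : ∀ h h′ x y → h + x ≡ y + h′ → x + q ≡ y + p → h + p ≡ h′ + q
        cancel h h′ x y e₁ e₂ = ℕ.+-cancelʳ-≡ y _ _ (begin
          h + p + y   ≡⟨ trans (ℕ.+-assoc h p y) (cong₂ _+_ {x = h} refl (ℕ.+-comm p y)) ⟩
          h + (y + p) ≡⟨ cong₂ _+_ {x = h} refl e₂ ⟨
          h + (x + q) ≡⟨ ℕ.+-assoc h x q ⟨
          h + x + q   ≡⟨ cong (_+ q) e₁ ⟩
          y + h′ + q  ≡⟨ trans (ℕ.+-assoc y h′ q) (ℕ.+-comm y (h′ + q)) ⟩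
          h′ + q + y  ∎)

    module _ (δ≡1 : n ≡ 0 → d ≡ 1ℤ) (β≡0 : n ≡ 1 → b ≡ 0ℤ) where

      -- Here the modulus is `a`: r - a ≈ r makes the gap terms of `gaps-balance` cancel, whatever
      -- their distribution.
      a∣β : a ℕ.∣ β
      a∣β = ≈0⇒∣ (balanced⇒≈0 b d n refl (balanced⇒invertible b d n δ≡1 β≡0 balanced) balanced)
        where
        open Counting a
        shift-a : ∀ r → r ℤ.- + a ≈ r [mod a ]
        shift-a r = divides -1ℤ (identity (+ a))
          where
          identity : ∀ k → r ℤ.- k ℤ.- r ≡ -1ℤ ℤ.* k
          identity k = solve (r ∷ k ∷ [])
        balanced : Balanced b d n
        balanced r = ℕ.+-cancelˡ-≡ (count r (H S)) _ _ (trans (gaps-balance a r)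
          (trans (cong₂ _+_ {x = count r (progression 1ℤ 1ℤ n)} refl (count-class (H S) (shift-a r)))
            (ℕ.+-comm (count r (progression 1ℤ 1ℤ n)) _)))

      -- If a and m have a common factor, h ↦ h + δ injects the gaps congruent to 1 - δ into those
      -- congruent to 1, and misses the gap 1.
      equidistributed⇒coprime : ∀ m → ((∀ x → x ∈ member S) → gcd a m ≡ 1) →
        Equidistributed m (H S) → gcd a m ≡ 1
      equidistributed⇒coprime m full equi with gcd a m ℕ.≟ 1
      ... | yes gcd≡1 = gcd≡1
      ... | no  gcd≢1 = contradiction too-many (ℕ.<-irrefl (equi (1ℤ ℤ.- d) 1ℤ))
        where
        open Counting m
        -- If 1 were in `S`, then `S` would be all of ℕ, where coprimality is assumed.
        1∉ : 1 ∉ member S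
        1∉ 1∈ = gcd≢1 (full (1∈⇒full 1∈))

        gap>0 : ∀ {h} → h ∈ₗ gaps S → 0 < h
        gap>0 {zero}  h∈ = contradiction 0∈ (∈-gaps⁻ h∈)
        gap>0 {suc h} h∈ = s≤s z≤n

        -- Otherwise `gcd a m` would divide both x and x - 1, hence 1.
        a∤ : ∀ {x} → + x ≈ 1ℤ [mod m ] → a ∤ x
        a∤ {x} x≈1 a∣x = gcd≢1 (ℕ.∣1⇒≡1 (≈0⇒∣ (combine₂ 1ℤ -1ℤ
          (∣⇒≈0 (ℕ.∣-trans (gcd[m,n]∣m a m) a∣x)) (≈-coarsen (+ x) 1ℤ (gcd[m,n]∣n a m) x≈1) (identity (+ x)))))
          where
          identity : ∀ y → 1ℤ ℤ.- 0ℤ ≡ 1ℤ ℤ.* (y ℤ.- 0ℤ) ℤ.+ -1ℤ ℤ.* (y ℤ.- 1ℤ)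
          identity = solve-∀

        shifted : List ℕ
        shifted = map (_+ δ) (gaps S)

        1-fresh : ∀ {x} → x ∈ₗ shifted → 1 ≢ x
        1-fresh x∈ 1≡x with ∈-map⁻ (_+ δ) x∈
        ... | h , h∈ , refl = ℕ.<⇒≢ (ℕ.+-mono-≤ (gap>0 h∈) 0<δ) 1≡x

        -- Restricting to the class of 1 is what makes `gap+δ` applicable: there `a` does not divide
        -- h + δ.
        in-gaps : ∀ {x} → x ∈ₗ map +_ (1 ∷ shifted) → x ≈ 1ℤ [mod m ] → x ∈ₗ H S
        in-gaps x∈ x≈1 with ∈-map⁻ +_ x∈
        ... | _ , here refl , refl = ∈-map⁺ +_ (∈-gaps⁺ 1∉)
        ... | _ , there y∈ , refl with ∈-map⁻ (_+ δ) y∈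
        ...   | h , h∈ , refl = ∈-map⁺ +_ (∈-gaps⁺ (gap+δ a∣β h (∈-gaps⁻ h∈) (a∤ x≈1)))

        too-many : count (1ℤ ℤ.- d) (H S) < count 1ℤ (H S)
        too-many = subst (_≤ count 1ℤ (H S))
          (trans (count-accept 1ℤ 1ℤ (map +_ shifted) (≈-refl 1ℤ)) (cong suc (sym (count-map-+ 1ℤ δ (gaps S)))))
          (unique-⊆⇒count-≤ 1ℤ
            (Unique.map⁺ ℤ.+-injective (All.tabulate 1-fresh AllPairs.∷
              Unique.map⁺ (ℕ.+-cancelʳ-≡ δ _ _) unique))
            (Unique.map⁺ ℤ.+-injective unique)
            in-gaps)

-- If `S` is all of ℕ there are no gaps, so equidistribution holds for every `m`, even when `a` and
-- `m` have a common factor; the last hypothesis excludes exactly that situation.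
theorem4p5 : (S : NumericalSemigroup) (a m β δ : ℕ) →
    a ∈ member S → a ≢ 0 → 0 < m → 0 < δ →
    Ap S a ≐ ZeroAndProgression a β δ →
    (a ≡ 1 → β ≡ 0 × δ ≡ 1) →
    (a ≡ 2 → β ≡ 0 × 2 ∤ δ) →
    ((∀ n → n ∈ member S) → gcd a m ≡ 1) →
    Equidistributed m (H S) ⇔
    (gcd (a * δ) m ≡ 1 ×
    (  + a ≈ + 1 [mod m ]
    ⊎ (+ a ≈ + 2 [mod m ] × + (β + δ) ≈ + 1 [mod m ])
    ⊎ (+ δ ≈ + 1 [mod m ] × + β ≈ + 0 [mod m ])
    ⊎ (+ δ ≈ -1ℤ [mod m ] × + β ≈ + a [mod m ])))
theorem4p5 S zero m β δ _ a≢0 _ _ _ _ _ _ = contradiction refl a≢0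
theorem4p5 S a@(suc n) m β δ a∈ _ 0<m 0<δ ap a≡1⇒ a≡2⇒ full⇒ = mk⇔ to from
  where
  open Semigroup S
  open Counting m
  instance
    m≢0 : NonZero m
    m≢0 = >-nonZero 0<m

  δ≡1 : n ≡ 0 → + δ ≡ 1ℤ
  δ≡1 n≡0 = cong +_ (proj₂ (a≡1⇒ (cong suc n≡0)))

  β≡0 : n ≡ 1 → + β ≡ 0ℤ
  β≡0 n≡1 = cong +_ (proj₁ (a≡2⇒ (cong suc n≡1)))

  to : Equidistributed m (H S) → gcd (a * δ) m ≡ 1 × Cases (+ β) (+ δ) (+ a)
  to equi = invertible⇒gcd≡1 (a * δ) (subst (λ x → Invertible x m) (sym (ℤ.pos-* a δ))
      (invertible-* (+ a) (+ δ) a-inv δ-inv))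
    , four-term⇒cases (+ β) (+ δ) (+ n) a-inv δ-inv (four-term (+ β) (+ δ) n balanced)
    where
    balanced : Balanced (+ β) (+ δ) n
    balanced = equidistributed⇒balanced n β δ a∈ 0<δ ap m equi
    a-inv : Invertible (+ a) m
    a-inv = gcd≡1⇒invertible a (equidistributed⇒coprime n β δ a∈ 0<δ ap δ≡1 β≡0 m full⇒ equi)
    δ-inv : Invertible (+ δ) m
    δ-inv = balanced⇒invertible (+ β) (+ δ) n δ≡1 β≡0 balanced

  from : gcd (a * δ) m ≡ 1 × Cases (+ β) (+ δ) (+ a) → Equidistributed m (H S)
  from (gcd≡1 , cases) = let p , q , e = cases⇒balanced-up-to-constant (+ β) (+ δ) n δ-inv cases in
    balanced-up-to-constant⇒equidistributed n β δ a∈ 0<δ ap m (invertible-*ˡ (+ a) (+ δ) aδ-inv) p q e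
    where
    aδ-inv : Invertible (+ a ℤ.* + δ) m
    aδ-inv = subst (λ x → Invertible x m) (ℤ.pos-* a δ) (gcd≡1⇒invertible (a * δ) gcd≡1)
    δ-inv : Invertible (+ δ) m
    δ-inv = invertible-*ʳ (+ a) (+ δ) aδ-inv
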